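{- Let $(X,d)$ be a metric space, $U$ a map from $X$ to $X$, $\varphi$ a map from $X\times X$ to $\mathbb{R}$ and $(u_n)_{n\in\mathbb{N}}$ a sequence of elements of $X$. Suppose that there are monotone functionals $\alpha$ and $\beta$ from $\mathbb{N}\times\mathbb{N}^{\mathbb{N}}$ to $\mathbb{N}$ satisfying: (a) for all $k\in\mathbb{N}$ and all monotone $f\in\mathbb{N}^{\mathbb{N}}$, $\exists N\leq\alpha(k,f)\ \forall n\in[N,f(N)]\left(d(U(u_n),u_n)<\frac{1}{k+1}\right)$; (b) for all $k\in\mathbb{N}$ and all monotone $f\in\mathbb{N}^{\mathbb{N}}$, there are $N\leq\beta(k,f)$ and $x\in X$ such that $$d(U(x),x)<\frac{1}{f(N)+1}\ \wedge\ \forall y\in X\left(d(U(y),y)\leq\frac{1}{N+1}\rightarrow\varphi(x,x)<\varphi(x,y)+\frac{1}{k+1}\right).$$ Then, for every $k\in\mathbb{N}$ and any monotone function $f\in\mathbb{N}^{\mathbb{N}}$, there is a natural number $N$ with $N\leq\psi(k,f)$ such that $$\exists x\in X\left(d(U(x),x)<\frac{1}{f(N)+1}\ \wedge\ \forall n\in[N,f(N)]\left(\varphi(x,x)<\varphi(x,u_n)+\frac{1}{k+1}\right)\right),$$ where $\psi(k,f)$ is the monotone functional given by $\psi(k,f):=\alpha(\beta(k,\widehat f),f)$, with $\widehat f$ the monotone function $m\mapsto f(\alpha(m,f))$.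
   Context: $[n,m]:=\{n,n+1,\ldots,m\}$ (empty if $m<n$). For $f,g\in\mathbb{N}^{\mathbb{N}}$, $g\leq^*f$ means $\forall n\forall k\leq n\,(g(k)\leq f(n)\wedge f(k)\leq f(n))$. A function $f\in\mathbb{N}^{\mathbb{N}}$ is monotone if $f\leq^*f$ (i.e. $f$ is nondecreasing). For functionals $\alpha,\beta:\mathbb{N}\times\mathbb{N}^{\mathbb{N}}\to\mathbb{N}$, $\alpha\leq^*\beta$ means $\forall n\forall f\forall k\leq n\forall g\leq^*f\,(\alpha(k,g)\leq\beta(n,f)\wedge\beta(k,g)\leq\beta(n,f))$; $\alpha$ is monotone if $\alpha\leq^*\alpha$. -}

module Defs where

open import Data.Integer.Base using (1ℤ)
open import Data.Nat.Base as ℕ using (ℕ; suc)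
import Data.Nat.Properties as ℕ
open import Data.Product.Base using (∃-syntax; _×_; _,_)
open import Data.Rational.Base as ℚ
  using (ℚ; 0ℚ; ½; _/_; _+_; _-_; -_; _*_; _<_; ∣_∣)
import Data.Rational.Properties as ℚ
open import Data.Rational.Solver using (module +-*-Solver)
open import Data.Sum.Base using (inj₁; inj₂)
open import Function.Metric.Core using (DistanceFunction)
open import Function.Metric.Structures using (IsGeneralMetric)
open import Level using (0ℓ; _⊔_) renaming (suc to lsuc)
open import Relation.Binary.Bundles using (Setoid)
open import Relation.Binary.Core using (Rel)
open import Relation.Binary.Structures using (IsEquivalence; IsPartialOrder)
open import Relation.Binary.PropositionalEquality.Core
  using (_≡_; refl; sym; trans; cong; subst)

Eventually : (ℕ → Set) → Set
Eventually P = ∃[ N ] (∀ n → N ℕ.≤ n → P n)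

IsCauchy : (ℕ → ℚ) → Set
IsCauchy s = ∀ ε → 0ℚ < ε →
  ∃[ N ] (∀ m n → N ℕ.≤ m → N ℕ.≤ n → ∣ s m - s n ∣ < ε)

-- Equality of real numbers is _≃ℝ_ (the difference tends to 0), not _≡_.
record ℝ : Set where
  constructor mkℝ
  field
    seq    : ℕ → ℚ
    cauchy : IsCauchy seq

open ℝ public

infix 4 _≃ℝ_ _≤ℝ_ _<ℝ_
infixl 6 _+ℝ_

_≃ℝ_ : Rel ℝ 0ℓ
x ≃ℝ y = ∀ ε → 0ℚ < ε → Eventually λ n → ∣ seq x n - seq y n ∣ < ε

_≤ℝ_ : Rel ℝ 0ℓ
x ≤ℝ y = ∀ ε → 0ℚ < ε → Eventually λ n → seq x n < seq y n + ε

-- The gap ε must not depend on n: eventual termwise strict inequality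
-- alone would make 0 less than the (null) sequence 1/(n+1).
_<ℝ_ : Rel ℝ 0ℓ
x <ℝ y = ∃[ ε ] (0ℚ < ε × Eventually λ n → seq x n + ε < seq y n)

private

  0<½* : ∀ {ε} → 0ℚ < ε → 0ℚ < ½ * ε
  0<½* {ε} 0<ε = subst (_< ½ * ε) (ℚ.*-zeroʳ ½) (ℚ.*-monoʳ-<-pos ½ 0<ε)

  ½*+½* : ∀ ε → ½ * ε + ½ * ε ≡ ε
  ½*+½* ε = trans (sym (ℚ.*-distribʳ-+ ε ½ ½)) (ℚ.*-identityˡ ε)

  ∣p-p∣<ε : ∀ p {ε} → 0ℚ < ε → ∣ p - p ∣ < ε
  ∣p-p∣<ε p {ε} = subst (_< ε) (sym (cong ∣_∣ (ℚ.+-inverseʳ p)))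

  ∣p-q∣≡∣q-p∣ : ∀ p q → ∣ p - q ∣ ≡ ∣ q - p ∣
  ∣p-q∣≡∣q-p∣ p q = trans (sym (ℚ.∣-p∣≡∣p∣ (p - q))) (cong ∣_∣ (swap p q))
    where
    open +-*-Solver
    swap : ∀ p q → - (p - q) ≡ q - p
    swap = solve 2 (λ p q → :- (p :- q) := q :- p) refl

  ∣+∣<ε : ∀ p q {ε} → ∣ p ∣ < ½ * ε → ∣ q ∣ < ½ * ε → ∣ p + q ∣ < ε
  ∣+∣<ε p q {ε} p< q< = ℚ.≤-<-trans (ℚ.∣p+q∣≤∣p∣+∣q∣ p q)
    (subst (∣ p ∣ + ∣ q ∣ <_) (½*+½* ε) (ℚ.+-mono-< p< q<))

  p≤∣p∣ : ∀ p → p ℚ.≤ ∣ p ∣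
  p≤∣p∣ p with ℚ.≤-total 0ℚ p
  ... | inj₁ 0≤p = ℚ.≤-reflexive (sym (ℚ.0≤p⇒∣p∣≡p 0≤p))
  ... | inj₂ p≤0 = ℚ.≤-trans p≤0 (ℚ.0≤∣p∣ p)

  p-q<r⇒p<q+r : ∀ p q r → p - q < r → p < q + r
  p-q<r⇒p<q+r p q r lt = subst (_< q + r) (eq p q) (ℚ.+-monoʳ-< q lt)
    where
    open +-*-Solver
    eq : ∀ p q → q + (p - q) ≡ p
    eq = solve 2 (λ p q → q :+ (p :- q) := p) refl

  p<q+r⇒p-q<r : ∀ p q r → p < q + r → p - q < r
  p<q+r⇒p-q<r p q r lt = subst (p - q <_) (eq q r) (ℚ.+-monoˡ-< (- q) lt)
    where
    open +-*-Solver
    eq : ∀ q r → q + r - q ≡ r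
    eq = solve 2 (λ q r → q :+ r :- q := r) refl

  both : ∀ {P Q R : ℕ → Set} → (∀ n → P n → Q n → R n) →
         Eventually P → Eventually Q → Eventually R
  both f (M , p) (N , q) = M ℕ.⊔ N , λ n le →
    f n (p n (ℕ.m⊔n≤o⇒m≤o M N le)) (q n (ℕ.m⊔n≤o⇒n≤o M N le))

_+ℝ_ : ℝ → ℝ → ℝ
seq (x +ℝ y) n = seq x n + seq y n
cauchy (x +ℝ y) ε 0<ε =
  let M , p = cauchy x (½ * ε) (0<½* 0<ε)
      N , q = cauchy y (½ * ε) (0<½* 0<ε)
  in M ℕ.⊔ N , λ m n ≤m ≤n →
    subst (λ r → ∣ r ∣ < ε) (regroup (seq x m) (seq x n) (seq y m) (seq y n))
      (∣+∣<ε (seq x m - seq x n) (seq y m - seq y n)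
        (p m n (ℕ.m⊔n≤o⇒m≤o M N ≤m) (ℕ.m⊔n≤o⇒m≤o M N ≤n))
        (q m n (ℕ.m⊔n≤o⇒n≤o M N ≤m) (ℕ.m⊔n≤o⇒n≤o M N ≤n)))
  where
  open +-*-Solver
  regroup : ∀ a b c d → (a - b) + (c - d) ≡ (a + c) - (b + d)
  regroup = solve 4 (λ a b c d → (a :- b) :+ (c :- d) := (a :+ c) :- (b :+ d)) refl

fromℚ : ℚ → ℝ
fromℚ q = mkℝ (λ _ → q) (λ ε 0<ε → 0 , λ _ _ _ _ → ∣p-p∣<ε q 0<ε)

0ℝ : ℝ
0ℝ = fromℚ 0ℚ

1/[1+_] : ℕ → ℝ
1/[1+ k ] = fromℚ (1ℤ / suc k)

≃ℝ-isEquivalence : IsEquivalence _≃ℝ_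
≃ℝ-isEquivalence = record
  { refl  = λ {x} ε 0<ε → 0 , λ n _ → ∣p-p∣<ε (seq x n) 0<ε
  ; sym   = λ {x} {y} x≃y ε 0<ε → let N , p = x≃y ε 0<ε in
      N , λ n le → subst (_< ε) (∣p-q∣≡∣q-p∣ (seq x n) (seq y n)) (p n le)
  ; trans = λ {x} {y} {z} x≃y y≃z ε 0<ε → both
      (λ n p q → subst (λ r → ∣ r ∣ < ε) (cancel (seq x n) (seq y n) (seq z n))
                   (∣+∣<ε (seq x n - seq y n) (seq y n - seq z n) p q))
      (x≃y (½ * ε) (0<½* 0<ε)) (y≃z (½ * ε) (0<½* 0<ε))
  }
  where
  open +-*-Solver
  cancel : ∀ a b c → (a - b) + (b - c) ≡ a - c
  cancel = solve 3 (λ a b c → (a :- b) :+ (b :- c) := a :- c) refl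

ℝ-setoid : Setoid 0ℓ 0ℓ
ℝ-setoid = record { isEquivalence = ≃ℝ-isEquivalence }

-- `IsGeneralMetric` has a field of this type; as it is always inhabited,
-- the field puts no restriction on the metric.
≤ℝ-isPartialOrder : IsPartialOrder _≃ℝ_ _≤ℝ_
≤ℝ-isPartialOrder = record
  { isPreorder = record
    { isEquivalence = ≃ℝ-isEquivalence
    ; reflexive     = λ {x} {y} x≃y ε 0<ε → let N , p = x≃y ε 0<ε in
        N , λ n le → p-q<r⇒p<q+r (seq x n) (seq y n) ε
          (ℚ.≤-<-trans (p≤∣p∣ (seq x n - seq y n)) (p n le))
    ; trans         = λ {x} {y} {z} x≤y y≤z ε 0<ε → both
        (λ n p q → ℚ.<-trans p
          (subst (seq y n + ½ * ε <_) (halves (seq z n) ε)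
            (ℚ.+-monoˡ-< (½ * ε) q)))
        (x≤y (½ * ε) (0<½* 0<ε)) (y≤z (½ * ε) (0<½* 0<ε))
    }
  ; antisym = λ {x} {y} x≤y y≤x ε 0<ε → both
      (λ n p q → ∣∣< (seq x n) (seq y n) ε p q) (x≤y ε 0<ε) (y≤x ε 0<ε)
  }
  where
  halves : ∀ r ε → r + ½ * ε + ½ * ε ≡ r + ε
  halves r ε = trans (ℚ.+-assoc r (½ * ε) (½ * ε)) (cong (r +_) (½*+½* ε))

  ∣∣< : ∀ p q ε → p < q + ε → q < p + ε → ∣ p - q ∣ < ε
  ∣∣< p q ε p< q< with ℚ.≤-total 0ℚ (p - q)
  ... | inj₁ 0≤p-q =
    subst (_< ε) (sym (ℚ.0≤p⇒∣p∣≡p 0≤p-q)) (p<q+r⇒p-q<r p q ε p<)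
  ... | inj₂ p-q≤0 = subst (_< ε)
    (trans (sym (ℚ.0≤p⇒∣p∣≡p 0≤q-p)) (∣p-q∣≡∣q-p∣ q p))
    (p<q+r⇒p-q<r q p ε q<)
    where
    open +-*-Solver
    swap : ∀ p q → - (p - q) ≡ q - p
    swap = solve 2 (λ p q → :- (p :- q) := q :- p) refl
    0≤q-p : 0ℚ ℚ.≤ q - p
    0≤q-p = subst (0ℚ ℚ.≤_) (swap p q) (ℚ.neg-antimono-≤ p-q≤0)

record MetricSpace a ℓ : Set (lsuc (a ⊔ ℓ)) where
  infix 4 _≈_
  field
    Carrier  : Set a
    _≈_      : Rel Carrier ℓ
    d        : DistanceFunction Carrier ℝ
    isMetric : IsGeneralMetric _≈_ _≃ℝ_ _≤ℝ_ 0ℝ _+ℝ_ d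

  open IsGeneralMetric isMetric public using (≈-isEquivalence)

  setoid : Setoid a ℓ
  setoid = record { isEquivalence = ≈-isEquivalence }

infix 4 _≤*_ _≤**_

_≤*_ : Rel (ℕ → ℕ) 0ℓ
g ≤* f = ∀ n k → k ℕ.≤ n → g k ℕ.≤ f n × f k ℕ.≤ f n

Monotone : (ℕ → ℕ) → Set
Monotone f = f ≤* f

Functional : Set
Functional = ℕ → (ℕ → ℕ) → ℕ

_≤**_ : Rel Functional 0ℓ
α ≤** β = ∀ n f k → k ℕ.≤ n → ∀ g → g ≤* f →
  α k g ℕ.≤ β n f × β k g ℕ.≤ β n f

MonotoneFunctional : Functional → Set
MonotoneFunctional α = α ≤** α

hat : Functional → (ℕ → ℕ) → (ℕ → ℕ)
hat α f m = f (α m f)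

ψ : Functional → Functional → Functional
ψ α β k f = α (β k (hat α f)) f

-- Apply (b) to hat α f to get N₀ and x, then (a) to N₀ and f to get N.  Points
-- u n with n ∈ [N, f N] are 1/(N₀+1)-approximate fixed points, so (b) applies to
-- y = u n.  Since N ≤ α(N₀, f), monotonicity of f gives f N ≤ f(α(N₀, f)), so x
-- is approximate enough for N as well.

{-# OPTIONS --safe #-}
module Submission where

open import Defs
open import Data.Integer.Base using (1ℤ; +≤+)
open import Data.Integer.Properties using (*-monoˡ-≤-nonNeg)
open import Data.Nat.Base using (ℕ; suc; _≤_; s≤s)
import Data.Nat.Properties as ℕ
open import Data.Product.Base using (∃-syntax; _×_; _,_; proj₁; proj₂)
open import Data.Product.Relation.Binary.Pointwise.NonDependent using (_×ₛ_)
open import Data.Rational.Base as ℚ using (0ℚ; _/_)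
import Data.Rational.Properties as ℚ
open import Data.Rational.Unnormalised.Base using (mkℚᵘ; *≤*)
import Data.Rational.Unnormalised.Properties as ℚᵘ
open import Function.Bundles using (Func; _⟨$⟩_)
open import Relation.Binary.PropositionalEquality.Core using (subst)

-- `_/_` normalises by a gcd and so is stuck on open terms; over unnormalised rationals the
-- comparison is plain cross-multiplication.
1/suc-antimono : ∀ {m n} → m ≤ n → 1ℤ / suc n ℚ.≤ 1ℤ / suc m
1/suc-antimono {m} {n} m≤n = ℚ.toℚᵘ-cancel-≤ (begin
  ℚ.toℚᵘ (1ℤ / suc n) ≃⟨ ℚ.toℚᵘ-fromℚᵘ (mkℚᵘ 1ℤ n) ⟩
  mkℚᵘ 1ℤ n           ≤⟨ *≤* (*-monoˡ-≤-nonNeg 1ℤ (+≤+ (s≤s m≤n))) ⟩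
  mkℚᵘ 1ℤ m           ≃⟨ ℚ.toℚᵘ-fromℚᵘ (mkℚᵘ 1ℤ m) ⟨
  ℚ.toℚᵘ (1ℤ / suc m) ∎)
  where open ℚᵘ.≤-Reasoning

p<p+ε : ∀ p {ε} → 0ℚ ℚ.< ε → p ℚ.< p ℚ.+ ε
p<p+ε p {ε} 0<ε = subst (ℚ._< p ℚ.+ ε) (ℚ.+-identityʳ p) (ℚ.+-monoʳ-< p 0<ε)

-- Bridges the strict bound supplied by (a) and the non-strict premise in (b).
<ℝ⇒≤ℝ : ∀ x y → x <ℝ y → x ≤ℝ y
<ℝ⇒≤ℝ x y (_ , 0<δ , N , x+δ<y) ε 0<ε = N , λ n N≤n →
  ℚ.<-trans (p<p+ε (seq x n) 0<δ)
    (ℚ.<-trans (x+δ<y n N≤n) (p<p+ε (seq y n) 0<ε))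

<ℝ-fromℚ-trans : ∀ x {p q} → x <ℝ fromℚ p → p ℚ.≤ q → x <ℝ fromℚ q
<ℝ-fromℚ-trans x (ε , 0<ε , N , x+ε<p) p≤q =
  ε , 0<ε , N , λ n N≤n → ℚ.<-≤-trans (x+ε<p n N≤n) p≤q

≤*⇒monotone : ∀ {f g} → g ≤* f → Monotone f
≤*⇒monotone g≤*f n k k≤n = let fk≤fn = proj₂ (g≤*f n k k≤n) in fk≤fn , fk≤fn

-- Relates two functions because `ψ-monotone` compares `β` at `hat α g` and `hat α f`; monotonicity
-- of `hat α f` is the case where `g` is `f`.
hat-mono : ∀ {α} → MonotoneFunctional α →
  ∀ {f g} → g ≤* f → hat α g ≤* hat α f
hat-mono {α} α-mono {f} {g} g≤*f n k k≤n =
  proj₁ (g≤*f _ _ (proj₁ (α-mono n f k k≤n g g≤*f))) ,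
  proj₂ (g≤*f _ _ (proj₁ (α-mono n f k k≤n f (≤*⇒monotone g≤*f))))

ψ-monotone : ∀ {α β} → MonotoneFunctional α → MonotoneFunctional β →
  MonotoneFunctional (ψ α β)
ψ-monotone {α} α-mono β-mono n f k k≤n g g≤*f =
  -- Both components of `α ≤** α` are the same inequality, so this pair is the goal as it stands.
  α-mono _ f _
    (proj₁ (β-mono n (hat α f) k k≤n (hat α g) (hat-mono α-mono g≤*f)))
    g g≤*f

proposition4p3 :
  ∀ {a ℓ} (X : MetricSpace a ℓ) (let open MetricSpace X)
    (U : Func setoid setoid)
    (φ : Func (setoid ×ₛ setoid) ℝ-setoid)
    (u : ℕ → Carrier)
    (α β : Functional) →
  MonotoneFunctional α →
  MonotoneFunctional β →
  (∀ k f → Monotone f →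
    ∃[ N ] (N ≤ α k f ×
      (∀ n → N ≤ n → n ≤ f N → d (U ⟨$⟩ u n) (u n) <ℝ 1/[1+ k ]))) →
  (∀ k f → Monotone f →
    ∃[ N ] ∃[ x ] (N ≤ β k f ×
      d (U ⟨$⟩ x) x <ℝ 1/[1+ f N ] ×
      (∀ y → d (U ⟨$⟩ y) y ≤ℝ 1/[1+ N ] →
        φ ⟨$⟩ (x , x) <ℝ (φ ⟨$⟩ (x , y)) +ℝ 1/[1+ k ]))) →
  (∀ f → Monotone f → Monotone (hat α f)) ×
  MonotoneFunctional (ψ α β) ×
  (∀ k f → Monotone f →
    ∃[ N ] (N ≤ ψ α β k f ×
      ∃[ x ] (d (U ⟨$⟩ x) x <ℝ 1/[1+ f N ] ×
        (∀ n → N ≤ n → n ≤ f N →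
          φ ⟨$⟩ (x , x) <ℝ (φ ⟨$⟩ (x , u n)) +ℝ 1/[1+ k ]))))
proposition4p3 X U φ u α β α-mono β-mono asymptotic minimising =
  (λ f f-mono → hat-mono α-mono f-mono) ,
  ψ-monotone α-mono β-mono ,
  λ k f f-mono →
    let open MetricSpace X using (d)
        N₀ , x , N₀≤β , Ux≈x , x-min =
          minimising k (hat α f) (hat-mono α-mono f-mono)
        N , N≤α , Uu≈u = asymptotic N₀ f f-mono
        -- Only the first argument of `α` grows, from `N₀` to `β k (hat α f)`; `f` is compared with
        -- itself.
        α≤ψ = proj₁ (α-mono _ f _ N₀≤β f f-mono)
    in N , ℕ.≤-trans N≤α α≤ψ , x ,
       -- The bound in `Ux≈x` is at `hat α f N₀`, which unfolds to `f (α N₀ f)`.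
       <ℝ-fromℚ-trans (d (U ⟨$⟩ x) x) Ux≈x
         (1/suc-antimono (proj₁ (f-mono _ _ N≤α))) ,
       λ n N≤n n≤fN → x-min (u n)
         (<ℝ⇒≤ℝ (d (U ⟨$⟩ u n) (u n)) 1/[1+ N₀ ] (Uu≈u n N≤n n≤fN))
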